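{- For every integer $k\ge 2$ and every integer $n\ge k(2k-1)$, \[ \mu_k(\mathbb Z_n)=2k. \]
   Context: $\mathbb Z_n$ denotes the (additive) cyclic group of order $n$. For a subset $S\subseteq \mathbb Z_n$, write $\sigma(S)=\sum_{s\in S}s\in\mathbb Z_n$. For $k\ge 2$, $\mu_k(\mathbb Z_n)$ is the least cardinality of a subset $S\subseteq\mathbb Z_n$ such that $k\mid |S|$, $\sigma(S)=0$, and $S$ admits no partition into zero-sum $k$-subsets, i.e. $S$ cannot be written as a disjoint union $T_1\sqcup\cdots\sqcup T_m$ ($m\ge0$) with $|T_i|=k$ and $\sigma(T_i)=0$ for all $i$ (the empty set has the empty partition, $m=0$). If no such subset $S$ exists, $\mu_k(\mathbb Z_n)=\infty$. -}

module Defs where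

open import Data.Nat.Base as ℕ using (ℕ; NonZero; _≤_)
open import Data.Nat.DivMod using (_mod_)
open import Data.Nat.Divisibility using (_∣_)
open import Data.Fin.Base using (Fin; toℕ)
open import Data.Fin.Subset using (Subset; ∣_∣; _∩_; ⋃; Empty)
open import Data.Fin.Subset.Properties using (_∈?_)
open import Data.List.Base using (List; foldr; filter; allFin)
open import Data.List.Relation.Unary.All using (All)
open import Data.List.Relation.Unary.AllPairs using (AllPairs)
open import Data.Product.Base using (∃-syntax; _×_)
open import Relation.Nullary.Negation.Core using (¬_)
open import Relation.Nullary.Construct.Add.Supremum using (_⁺; ⊤⁺; [_])
open import Relation.Binary.PropositionalEquality.Core using (_≡_)

-- The cyclic group of order n is carried by Fin n (residues 0, …, n ∸ 1);
-- NonZero n is needed for it to have an identity.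
module _ {n : ℕ} .{{_ : NonZero n}} where

  infixl 6 _+ₙ_

  0ₙ : Fin n
  0ₙ = 0 mod n

  _+ₙ_ : Fin n → Fin n → Fin n
  a +ₙ b = (toℕ a ℕ.+ toℕ b) mod n

  σ : Subset n → Fin n
  σ S = foldr _+ₙ_ 0ₙ (filter (_∈? S) (allFin n))

  ZeroSum : Subset n → Set
  ZeroSum S = σ S ≡ 0ₙ

Disjoint : ∀ {n} → Subset n → Subset n → Set
Disjoint T U = Empty (T ∩ U)

module _ (k : ℕ) {n : ℕ} .{{_ : NonZero n}} where

  IsZeroSumPartition : List (Subset n) → Subset n → Set
  IsZeroSumPartition Ts S =
    All (λ T → ∣ T ∣ ≡ k × ZeroSum T) Ts × AllPairs Disjoint Ts × ⋃ Ts ≡ S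

  -- The subsets over which the minimum defining μ_k(ℤ_n) is taken.
  Unpartitionable : Subset n → Set
  Unpartitionable S =
    k ∣ ∣ S ∣ × ZeroSum S × ¬ (∃[ Ts ] IsZeroSumPartition Ts S)

-- Isμ k n x means μ_k(ℤ_n) = x, where x ∈ ℕ ∪ {∞} and ⊤⁺ is ∞.  As a least
-- cardinality it is given by its graph: at most one x satisfies it.
Isμ : (k n : ℕ) .{{_ : NonZero n}} → ℕ ⁺ → Set
Isμ k n [ m ] =
  (∃[ S ] Unpartitionable k {n} S × ∣ S ∣ ≡ m) ×
  (∀ (S : Subset n) → Unpartitionable k S → m ≤ ∣ S ∣)
Isμ k n ⊤⁺ = ¬ (∃[ S ] Unpartitionable k {n} S)

{-# OPTIONS --safe #-}

-- For |S| < 2k the only cases are S = ∅ and |S| = k, which partition trivially.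
-- For |S| = 2k take S = {x} ∪ {0, …, 2k − 2} with x = n − (k − 1)(2k − 1).  One of
-- the two blocks of a partition avoids x, and its elements, being distinct and at
-- most 2k − 2, have a natural-number sum strictly between 0 and n.
module Submission where

open import Defs
open import Data.Nat.Base using (ℕ; NonZero; _*_; _∸_; _≥_)
open import Relation.Nullary.Construct.Add.Supremum using ([_])

open import Data.Nat.Base using (zero; suc; _+_; _≤_; _<_; s≤s; z≤n; _%_)
open import Data.Nat.Divisibility using (divides)
open import Data.Nat.DivMod using (%-distribˡ-+; m%n%n≡m%n; m%n<n; m<n⇒m%n≡m; m*n%n≡0; n%n≡0)
open import Data.Nat.ListAction using (sum)
open import Data.Nat.ListAction.Properties using (sum-↭)
open import Data.Nat.Properties
open import Data.Nat.Solver using (module +-*-Solver)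
open import Data.Fin.Base using (Fin; zero; suc; toℕ; fromℕ<; inject≤)
open import Data.Fin.Properties
  using (toℕ-fromℕ<; toℕ-inject≤; toℕ-injective; toℕ<n; inject≤-injective)
open import Data.Fin.Subset
  using (Subset; Empty; ∣_∣; ⁅_⁆; _∪_; ⋃; _∈_; _∉_; inside; outside)
open import Data.Fin.Subset.Properties
  using (_∈?_; ∉⊥; ∣⊥∣≡0; ∣⁅x⁆∣≡1; x∈⁅x⁆; x∈⁅y⁆⇒x≡y; p⊆q⇒∣p∣≤∣q∣; p⊆p∪q; q⊆p∪q;
         x∈p∪q⁺; x∈p∪q⁻; x∈p∩q⁺; ∪-identityʳ; Empty-unique)
open import Data.List.Base
  using (List; []; _∷_; map; filter; tabulate; allFin; length; foldr; upTo; applyUpTo; downFrom; reverse)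
open import Data.List.Membership.Propositional using () renaming (_∈_ to _∈ₗ_)
open import Data.List.Membership.Propositional.Properties
  using (∈-filter⁺; ∈-filter⁻; ∈-allFin; ∈-tabulate⁻)
open import Data.List.Membership.Propositional.Properties.WithK using (unique∧set⇒bag)
open import Data.List.Properties
  using (map-tabulate; length-tabulate; tabulate-cong; reverse-upTo)
open import Data.List.Relation.Binary.BagAndSetEquality using (∼bag⇒↭)
open import Data.List.Relation.Binary.Permutation.Propositional using (_↭_)
open import Data.List.Relation.Binary.Permutation.Propositional.Properties
  using (map⁺; ↭-length; ↭-reverse)
open import Data.List.Relation.Unary.All using ([]; _∷_) renaming (tabulate to All-tabulate)
open import Data.List.Relation.Unary.AllPairs using ([]; _∷_)
open import Data.List.Relation.Unary.Any using (here; there)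
open import Data.List.Relation.Unary.Unique.Propositional using (Unique)
import Data.List.Relation.Unary.Unique.Propositional.Properties as Unique
open import Data.Product.Base using (_×_; _,_; proj₂; ∃-syntax)
open import Data.Sum.Base using (_⊎_; inj₁; inj₂)
open import Data.Vec.Base using ([]; _∷_)
open import Function.Base using (_∘_; id)
open import Function.Bundles using (mk⇔)
open import Relation.Binary.PropositionalEquality
open import Relation.Nullary using (¬_; yes; no; contradiction)

-- Subset sums lifted to the natural numbers.

-- The very list that `σ` folds over, so facts about `foldr _+ₙ_ 0ₙ` apply to `σ S` directly.
elements : ∀ {n} → Subset n → List (Fin n)
elements {n} S = filter (_∈? S) (allFin n)

total : ∀ {n} → Subset n → ℕ
total S = sum (map toℕ (elements S))

∈-elements⁺ : ∀ {n} {S : Subset n} {x} → x ∈ S → x ∈ₗ elements S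
∈-elements⁺ {S = S} {x} = ∈-filter⁺ (_∈? S) (∈-allFin x)

∈-elements⁻ : ∀ {n} {S : Subset n} {x} → x ∈ₗ elements S → x ∈ S
∈-elements⁻ {n} {S} = proj₂ ∘ ∈-filter⁻ (_∈? S) {xs = allFin n}

-- The tail of `allFin (suc n)` is `tabulate suc`. Induction on `m` replaces `f` by `f ∘ suc`, hence
-- the general `f`.
length-filter-suc : ∀ {n m} b (S : Subset n) (f : Fin m → Fin n) →
  length (filter (_∈? (b ∷ S)) (tabulate (suc ∘ f))) ≡ length (filter (_∈? S) (tabulate f))
length-filter-suc {m = zero}  b S f = refl
length-filter-suc {m = suc m} b S f with f zero ∈? S
... | yes _ = cong suc (length-filter-suc b S (f ∘ suc))
... | no  _ = length-filter-suc b S (f ∘ suc)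

length-elements : ∀ {n} (S : Subset n) → length (elements S) ≡ ∣ S ∣
length-elements []            = refl
length-elements (outside ∷ S) =
  trans (length-filter-suc outside S id) (length-elements S)
length-elements (inside ∷ S)  =
  cong suc (trans (length-filter-suc inside S id) (length-elements S))

toℕ-foldr : ∀ {n} .{{_ : NonZero n}} (xs : List (Fin n)) →
  toℕ (foldr _+ₙ_ 0ₙ xs) ≡ sum (map toℕ xs) % n
toℕ-foldr {n} []       = toℕ-fromℕ< (m%n<n 0 n)
toℕ-foldr {n} (x ∷ xs) = begin
  toℕ (x +ₙ foldr _+ₙ_ 0ₙ xs)               ≡⟨ toℕ-fromℕ< (m%n<n (toℕ x + _) n) ⟩
  (toℕ x + toℕ (foldr _+ₙ_ 0ₙ xs)) % n      ≡⟨ cong (λ s → (toℕ x + s) % n) (toℕ-foldr xs) ⟩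
  (toℕ x + s % n) % n                       ≡⟨ %-distribˡ-+ (toℕ x) (s % n) n ⟩
  (toℕ x % n + s % n % n) % n               ≡⟨ cong (λ r → (toℕ x % n + r) % n) (m%n%n≡m%n s n) ⟩
  (toℕ x % n + s % n) % n                   ≡⟨ %-distribˡ-+ (toℕ x) s n ⟨
  (toℕ x + s) % n                           ∎
  where
  open ≡-Reasoning
  s = sum (map toℕ xs)

toℕ-σ : ∀ {n} .{{_ : NonZero n}} (S : Subset n) → toℕ (σ S) ≡ total S % n
toℕ-σ S = toℕ-foldr (elements S)

toℕ-0ₙ : ∀ {n} .{{_ : NonZero n}} → toℕ (0ₙ {n}) ≡ 0
toℕ-0ₙ {n} = trans (toℕ-fromℕ< (m%n<n 0 n)) (m*n%n≡0 0 n)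

-- Sets of small residues.

sum-≤ : ∀ {n b} (xs : List (Fin n)) → (∀ {x} → x ∈ₗ xs → toℕ x ≤ b) →
  sum (map toℕ xs) ≤ length xs * b
sum-≤ []       _  = z≤n
sum-≤ (x ∷ xs) ≤b = +-mono-≤ (≤b (here refl)) (sum-≤ xs (≤b ∘ there))

sum≡0⇒≡0 : ∀ {n} (xs : List (Fin n)) → sum (map toℕ xs) ≡ 0 → ∀ {x} → x ∈ₗ xs → toℕ x ≡ 0
sum≡0⇒≡0 (x ∷ xs) eq (here refl) = m+n≡0⇒m≡0 (toℕ x) eq
sum≡0⇒≡0 (x ∷ xs) eq (there x∈)  = sum≡0⇒≡0 xs (m+n≡0⇒n≡0 (toℕ x) eq) x∈

-- A vanishing sum of naturals has only zero terms, so `S` lies in `⁅ 0ₙ ⁆`. The bound is 1 because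
-- 0 itself may be an element.
total≡0⇒∣S∣≤1 : ∀ {n} .{{_ : NonZero n}} (S : Subset n) → total S ≡ 0 → ∣ S ∣ ≤ 1
total≡0⇒∣S∣≤1 S eq = subst (∣ S ∣ ≤_) (∣⁅x⁆∣≡1 0ₙ) (p⊆q⇒∣p∣≤∣q∣ S⊆⁅0⁆)
  where
  S⊆⁅0⁆ : ∀ {x} → x ∈ S → x ∈ ⁅ 0ₙ ⁆
  S⊆⁅0⁆ x∈S = subst (_∈ ⁅ 0ₙ ⁆)
    (toℕ-injective (trans toℕ-0ₙ (sym (sum≡0⇒≡0 (elements S) eq (∈-elements⁺ x∈S))))) (x∈⁅x⁆ 0ₙ)

-- The total is at most `∣ T ∣ * b`, hence below `n`, so reduction modulo `n` leaves it unchanged. A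
-- zero sum would make the total itself 0, which two distinct residues rule out.
small⇒¬ZeroSum : ∀ {n} .{{_ : NonZero n}} {b} (T : Subset n) → 2 ≤ ∣ T ∣ →
  (∀ {x} → x ∈ T → toℕ x ≤ b) → ∣ T ∣ * b < n → ¬ ZeroSum T
small⇒¬ZeroSum {n} {b} T 2≤∣T∣ ≤b <n zs = <⇒≱ 2≤∣T∣ (total≡0⇒∣S∣≤1 T total≡0)
  where
  total<n : total T < n
  total<n = ≤-<-trans (sum-≤ (elements T) (≤b ∘ ∈-elements⁻))
    (subst (λ c → c * b < n) (sym (length-elements T)) <n)

  total≡0 : total T ≡ 0
  total≡0 = trans (sym (m<n⇒m%n≡m total<n))
    (trans (sym (toℕ-σ T)) (trans (cong toℕ zs) toℕ-0ₙ))

-- Subsets given by duplicate-free lists.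

fromList : ∀ {n} → List (Fin n) → Subset n
fromList = ⋃ ∘ map ⁅_⁆

∈-fromList⁺ : ∀ {n} {x : Fin n} {xs} → x ∈ₗ xs → x ∈ fromList xs
∈-fromList⁺ (here refl) = x∈p∪q⁺ (inj₁ (x∈⁅x⁆ _))
∈-fromList⁺ (there x∈)  = x∈p∪q⁺ (inj₂ (∈-fromList⁺ x∈))

∈-fromList⁻ : ∀ {n} {x : Fin n} xs → x ∈ fromList xs → x ∈ₗ xs
∈-fromList⁻ []       x∈ = contradiction x∈ ∉⊥
∈-fromList⁻ (y ∷ xs) x∈ with x∈p∪q⁻ ⁅ y ⁆ (fromList xs) x∈
... | inj₁ x∈⁅y⁆ = here (x∈⁅y⁆⇒x≡y y x∈⁅y⁆)
... | inj₂ x∈xs  = there (∈-fromList⁻ xs x∈xs)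

-- Two duplicate-free lists with the same members are permutations of each other. Cardinality and
-- total of `fromList xs` can then be read off `xs`.
elements-fromList : ∀ {n} {xs : List (Fin n)} → Unique xs → elements (fromList xs) ↭ xs
elements-fromList {n} {xs} xs! = ∼bag⇒↭ (unique∧set⇒bag
  (Unique.filter⁺ (_∈? fromList xs) (Unique.allFin⁺ n)) xs!
  (mk⇔ (∈-fromList⁻ xs ∘ ∈-elements⁻) (∈-elements⁺ ∘ ∈-fromList⁺)))

tabulate-toℕ : ∀ {A : Set} m (f : ℕ → A) → tabulate {n = m} (f ∘ toℕ) ≡ applyUpTo f m
tabulate-toℕ zero    f = refl
tabulate-toℕ (suc m) f = cong (f 0 ∷_) (tabulate-toℕ m (f ∘ suc))

-- With an odd number of terms the triangular number needs no division. `downFrom` has its largest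
-- terms in front, so the induction step peels off `2 + 2 * j` and `1 + 2 * j`.
sum-downFrom-odd : ∀ j → sum (downFrom (1 + 2 * j)) ≡ j * (1 + 2 * j)
sum-downFrom-odd zero    = refl
sum-downFrom-odd (suc j) = begin
  sum (downFrom (1 + 2 * suc j))        ≡⟨ cong (λ i → sum (downFrom (1 + i))) (*-suc 2 j) ⟩
  2 + 2 * j + (1 + 2 * j + sum (downFrom (1 + 2 * j)))
    ≡⟨ cong (λ s → 2 + 2 * j + (1 + 2 * j + s)) (sum-downFrom-odd j) ⟩
  2 + 2 * j + (1 + 2 * j + j * (1 + 2 * j))
    ≡⟨ solve 1 (λ j → con 2 :+ con 2 :* j :+ (con 1 :+ con 2 :* j :+ j :* (con 1 :+ con 2 :* j))
              := (con 1 :+ j) :* (con 1 :+ con 2 :* (con 1 :+ j))) refl j ⟩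
  suc j * (1 + 2 * suc j)               ∎
  where
  open +-*-Solver
  open ≡-Reasoning

sum-upTo-odd : ∀ j → sum (upTo (1 + 2 * j)) ≡ j * (1 + 2 * j)
sum-upTo-odd j = begin
  sum (upTo (1 + 2 * j))            ≡⟨ sum-↭ (↭-reverse (upTo (1 + 2 * j))) ⟨
  sum (reverse (upTo (1 + 2 * j)))  ≡⟨ cong sum (reverse-upTo (1 + 2 * j)) ⟩
  sum (downFrom (1 + 2 * j))        ≡⟨ sum-downFrom-odd j ⟩
  j * (1 + 2 * j)                   ∎
  where open ≡-Reasoning

-- Blocks of a partition and the lower bound.

disjoint⇒∉ : ∀ {n} {T U : Subset n} → Disjoint T U → ∀ x → x ∉ T ⊎ x ∉ U
disjoint⇒∉ {T = T} T∩U=∅ x with x ∈? T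
... | no  x∉T = inj₁ x∉T
... | yes x∈T = inj₂ λ x∈U → T∩U=∅ (x , x∈p∩q⁺ (x∈T , x∈U))

-- No block or a single block would give `S` size 0 or `k`, neither of which is `2 * k`. Any longer
-- list starts with two disjoint blocks, and `x` is missing from one of them.
partition-block-avoiding : ∀ {k n} .{{_ : NonZero n}} {Ts} {S : Subset n} →
  1 ≤ k → ∣ S ∣ ≡ 2 * k → IsZeroSumPartition k Ts S → ∀ x →
  ∃[ T ] (∣ T ∣ ≡ k × ZeroSum T × (∀ {y} → y ∈ T → y ∈ S) × x ∉ T)
partition-block-avoiding {k} {n} {Ts = []} 1≤k ∣S∣≡2k (_ , _ , refl) _ =
  contradiction (trans (sym ∣S∣≡2k) (∣⊥∣≡0 n)) (>⇒≢ (≤-trans 1≤k (m≤m+n k _)))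
partition-block-avoiding {k} {Ts = T ∷ []} 1≤k ∣S∣≡2k ((∣T∣≡k , _) ∷ [] , _ , refl) _ =
  contradiction (trans (sym (trans (cong ∣_∣ (∪-identityʳ T)) ∣T∣≡k)) ∣S∣≡2k)
    (<⇒≢ (m<m+n k (≤-trans 1≤k (m≤m+n k 0))))
partition-block-avoiding {Ts = T ∷ U ∷ Ts} _ _
  ((∣T∣≡k , zsT) ∷ (∣U∣≡k , zsU) ∷ _ , (T#U ∷ _) ∷ _ , refl) x with disjoint⇒∉ T#U x
... | inj₁ x∉T = T , ∣T∣≡k , zsT , p⊆p∪q (U ∪ ⋃ Ts) , x∉T
... | inj₂ x∉U = U , ∣U∣≡k , zsU , q⊆p∪q T (U ∪ ⋃ Ts) ∘ p⊆p∪q (⋃ Ts) , x∉U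

-- The split is on the quotient of `∣ S ∣` by `k`: for 0 and 1 the lists `[]` and `S ∷ []` are
-- partitions.
unpartitionable⇒2k≤∣S∣ : ∀ {k n} .{{_ : NonZero n}} (S : Subset n) →
  Unpartitionable k S → 2 * k ≤ ∣ S ∣
unpartitionable⇒2k≤∣S∣ {k} S (divides 0 ∣S∣≡0 , _ , ¬part) =
  contradiction ([] , [] , [] , sym (Empty-unique S-empty)) ¬part
  where
  S-empty : Empty S
  S-empty (x , x∈S) = contradiction
    (subst₂ _≤_ (∣⁅x⁆∣≡1 x) ∣S∣≡0
      (p⊆q⇒∣p∣≤∣q∣ λ y∈ → subst (_∈ S) (sym (x∈⁅y⁆⇒x≡y x y∈)) x∈S)) λ ()
unpartitionable⇒2k≤∣S∣ {k} S (divides 1 ∣S∣≡k , zs , ¬part) =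
  contradiction
    (S ∷ [] , (trans ∣S∣≡k (*-identityˡ k) , zs) ∷ [] , [] ∷ [] , ∪-identityʳ S) ¬part
unpartitionable⇒2k≤∣S∣ {k} S (divides (suc (suc q)) ∣S∣≡qk , _) =
  subst (2 * k ≤_) (sym ∣S∣≡qk) (*-monoˡ-≤ k {2} {2 + q} (s≤s (s≤s z≤n)))

-- The extremal set.

-- With `k` written as `suc j`, the numbers `k - 1` and `2k - 1` become `j` and `1 + 2 * j`, free of
-- truncated subtraction.
module Extremal (j n : ℕ) .{{_ : NonZero n}} (1≤j : 1 ≤ j)
                (large : suc j * (1 + 2 * j) ≤ n) where

  m : ℕ
  m = 1 + 2 * j

  jm≤n : j * m ≤ n
  -- `large` unfolds to `m + j * m ≤ n`, which bounds either summand.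
  jm≤n = ≤-trans (m≤n+m (j * m) m) large

  m≤n : m ≤ n
  m≤n = ≤-trans (m≤m+n m (j * m)) large

  n∸jm<n : n ∸ j * m < n
  -- Strictness needs `j * m` positive, which `1≤j` provides.
  n∸jm<n = ∸-monoʳ-< (*-mono-≤ 1≤j (s≤s z≤n)) jm≤n

  -- The residues below `m` add up to `j * m`, so this element brings the total to exactly `n`.
  x : Fin n
  x = fromℕ< n∸jm<n

  toℕ-x : toℕ x ≡ n ∸ j * m
  toℕ-x = toℕ-fromℕ< n∸jm<n

  -- A rearrangement of `large`. It keeps `x` out of `initial`, so that `S` really has `2k`
  -- elements.
  m≤x : m ≤ toℕ x
  m≤x = subst (m ≤_) (sym toℕ-x) (m+n≤o⇒m≤o∸n m large)

  initial : List (Fin n)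
  initial = tabulate {n = m} (λ i → inject≤ i m≤n)

  ∈-initial⇒< : ∀ {y} → y ∈ₗ initial → toℕ y < m
  ∈-initial⇒< y∈ with i , refl ← ∈-tabulate⁻ {f = λ i → inject≤ i m≤n} y∈ =
    subst (_< m) (sym (toℕ-inject≤ i m≤n)) (toℕ<n i)

  xs : List (Fin n)
  xs = x ∷ initial

  xs! : Unique xs
  xs! = All-tabulate (λ { y∈ refl → <⇒≱ (∈-initial⇒< y∈) m≤x })
      ∷ Unique.tabulate⁺ (inject≤-injective m≤n m≤n _ _)

  S : Subset n
  S = fromList xs

  ∣S∣≡2k : ∣ S ∣ ≡ 2 * suc j
  ∣S∣≡2k = begin
    ∣ S ∣                ≡⟨ length-elements S ⟨
    length (elements S)  ≡⟨ ↭-length (elements-fromList xs!) ⟩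
    1 + length initial   ≡⟨ cong suc (length-tabulate (λ i → inject≤ i m≤n)) ⟩
    1 + m                ≡⟨ *-suc 2 j ⟨
    2 * suc j            ∎
    where open ≡-Reasoning

  sum-initial : sum (map toℕ initial) ≡ j * m
  sum-initial = begin
    sum (map toℕ initial)                          ≡⟨ cong sum (map-tabulate (λ i → inject≤ i m≤n) toℕ) ⟩
    sum (tabulate {n = m} (λ i → toℕ (inject≤ i m≤n))) ≡⟨ cong sum (tabulate-cong (λ i → toℕ-inject≤ i m≤n)) ⟩
    sum (tabulate {n = m} toℕ)                     ≡⟨ cong sum (tabulate-toℕ m id) ⟩
    sum (upTo m)                                   ≡⟨ sum-upTo-odd j ⟩
    j * m                                          ∎
    where open ≡-Reasoning

  total-S : total S ≡ n
  total-S = begin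
    total S                         ≡⟨ sum-↭ (map⁺ toℕ (elements-fromList xs!)) ⟩
    toℕ x + sum (map toℕ initial)   ≡⟨ cong₂ _+_ toℕ-x sum-initial ⟩
    n ∸ j * m + j * m               ≡⟨ m∸n+n≡m jm≤n ⟩
    n                               ∎
    where open ≡-Reasoning

  S-zeroSum : ZeroSum S
  S-zeroSum = toℕ-injective (begin
    toℕ (σ S)    ≡⟨ toℕ-σ S ⟩
    total S % n  ≡⟨ cong (_% n) total-S ⟩
    n % n        ≡⟨ n%n≡0 n ⟩
    0            ≡⟨ toℕ-0ₙ ⟨
    toℕ (0ₙ {n}) ∎)
    where open ≡-Reasoning

  S∖x-≤ : ∀ {y} → y ∈ S → y ≢ x → toℕ y ≤ 2 * j
  S∖x-≤ y∈S y≢x with ∈-fromList⁻ xs y∈S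
  ... | here y≡x = contradiction y≡x y≢x
  ... | there y∈ = ≤-pred (∈-initial⇒< y∈)

  S-unpartitionable : Unpartitionable (suc j) S
  S-unpartitionable = divides 2 ∣S∣≡2k , S-zeroSum , ¬partition
    where
    ¬partition : ¬ (∃[ Ts ] IsZeroSumPartition (suc j) Ts S)
    ¬partition (_ , part) with T , ∣T∣≡k , zs , T⊆S , x∉T ←
      partition-block-avoiding (s≤s z≤n) ∣S∣≡2k part x =
      -- The singleton of 0 is zero-sum; `k ≥ 2` excludes such a block.
      small⇒¬ZeroSum T (subst (2 ≤_) (sym ∣T∣≡k) (s≤s 1≤j))
        (λ y∈T → S∖x-≤ (T⊆S y∈T) λ { refl → x∉T y∈T })
        (subst (λ c → c * (2 * j) < n) (sym ∣T∣≡k)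
          -- Size times maximum is a sufficient bound: `k * (2k - 2) < k * (2k - 1) ≤ n`.
          (<-≤-trans (*-monoʳ-< (suc j) (n<1+n (2 * j))) large))
        zs

proposition3p1 : (k n : ℕ) .{{_ : NonZero n}} → k ≥ 2 → n ≥ k * (2 * k ∸ 1) →
    Isμ k n [ 2 * k ]
proposition3p1 (suc j) n (s≤s 1≤j) large =
  (S , S-unpartitionable , ∣S∣≡2k) , unpartitionable⇒2k≤∣S∣
  where
  open Extremal j n 1≤j
    -- Turns `2 * suc j ∸ 1` into `1 + 2 * j`.
    (subst (λ c → suc j * c ≤ n) (cong (_∸ 1) (*-suc 2 j)) large)
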